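{- Let $\mathbf{CA}$ be the category of convex algebras and convex algebra homomorphisms. Let $F:\mathbf{CA}\to\mathbf{CA}$ be a functor such that for every object $\mathbb X$ the algebra $\mathbb X$ is a subalgebra of $F\mathbb X$ and the carrier of $F\mathbb X$ is $X\cup\{*\}$ with $*\notin X$, and such that for every morphism $f:\mathbb X\to\mathbb Y$ one has $(Ff)\circ\iota_X=\iota_Y\circ f$, where $\iota_X:\mathbb X\to F\mathbb X$ and $\iota_Y:\mathbb Y\to F\mathbb Y$ are the inclusion maps. Then for every $\mathbb X$ the algebra $F\mathbb X$ is the black-hole extension of $\mathbb X$, and for every $f:\mathbb X\to\mathbb Y$ the map $Ff$ is the extension of $f$ that maps $*$ (of $F\mathbb X$) to $*$ (of $F\mathbb Y$).
   Context: For $p\in[0,1]$ write $\bar p=1-p$. A convex algebra $\mathbb X$ is a set $X$ with an operation $(x_0,\dots,x_n)\mapsto\sum_{i=0}^n p_ix_i$ for every $n\in\mathbb N$ and all $p_0,\dots,p_n\in[0,1]$ with $\sum_i p_i=1$, such that (Projection) $\sum_i p_ix_i=x_j$ if $p_j=1$, and (Barycenter) $\sum_{i=0}^n p_i\big(\sum_{j=0}^m q_{i,j}x_j\big)=\sum_{j=0}^m\big(\sum_{i=0}^n p_iq_{i,j}\big)x_j$. A homomorphism (convex map) is a map $h$ with $h(\sum_i p_ix_i)=\sum_i p_ih(x_i)$. (The category $\mathbf{CA}$ is the Eilenberg–Moore category of the finitely supported distribution monad on sets.) The symbol $*$ denotes the unique element of the carrier of $F\mathbb X$ not in $X$; it may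 depend on $\mathbb X$. The black-hole extension of $\mathbb X$ is the convex algebra with carrier $X\cup\{*\}$ whose operations extend those of $\mathbb X$ and satisfy $px+\bar p*=*$ for all $x\in X$, $p\in(0,1)$. -}

module Defs where

open import Algebra.Bundles using (CommutativeRing)
open import Algebra.Structures using (IsCommutativeRing)
open import Data.Fin.Base using (Fin; zero; suc)
open import Data.Nat.Base as ℕ using (ℕ; suc)
import Data.Nat.Properties as ℕₚ
open import Data.Product.Base using (∃-syntax; _×_; _,_)
open import Data.Rational.Base as ℚ using (ℚ; 0ℚ; 1ℚ; ½)
import Data.Rational.Properties as ℚₚ
open import Data.Rational.Solver using (module +-*-Solver)
open import Data.Sum.Base using (_⊎_; inj₁; inj₂)
open import Data.Vec.Functional using ([]; _∷_)
open import Function.Base using (_∘_)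
open import Level using (Level; _⊔_) renaming (suc to lsuc)
open import Relation.Binary.Bundles using (Setoid)
open import Relation.Binary.PropositionalEquality as ≡ using (_≡_; refl; cong; cong₂; subst; subst₂)
open import Relation.Nullary.Negation using (¬_)

private
  variable
    c ℓ c′ ℓ′ c″ ℓ″ : Level

------------------------------------------------------------------------
-- Rational estimates

module Estimates where
  open +-*-Solver

  dist : ℚ → ℚ → ℚ
  dist p q = ℚ.∣ p ℚ.- q ∣

  abstract
    dist-self : ∀ p → dist p p ≡ 0ℚ
    dist-self p = cong ℚ.∣_∣ (ℚₚ.+-inverseʳ p)

    dist-sym : ∀ p q → dist p q ≡ dist q p
    dist-sym p q = ≡.trans (cong ℚ.∣_∣ (solve 2 (λ p q → p :- q := :- (q :- p)) refl p q))
                           (ℚₚ.∣-p∣≡∣p∣ (q ℚ.- p))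

    dist-neg : ∀ p q → dist (ℚ.- p) (ℚ.- q) ≡ dist p q
    dist-neg p q = ≡.trans (cong ℚ.∣_∣ (solve 2 (λ p q → :- p :- :- q := :- (p :- q)) refl p q))
                           (ℚₚ.∣-p∣≡∣p∣ (p ℚ.- q))

    dist-triangle : ∀ p q r → dist p r ℚ.≤ dist p q ℚ.+ dist q r
    dist-triangle p q r = subst (ℚ._≤ dist p q ℚ.+ dist q r)
      (cong ℚ.∣_∣ (solve 3 (λ p q r → (p :- q) :+ (q :- r) := p :- r) refl p q r))
      (ℚₚ.∣p+q∣≤∣p∣+∣q∣ (p ℚ.- q) (q ℚ.- r))

    dist-+ : ∀ p q r s → dist (p ℚ.+ q) (r ℚ.+ s) ℚ.≤ dist p r ℚ.+ dist q s
    dist-+ p q r s = subst (ℚ._≤ dist p r ℚ.+ dist q s)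
      (cong ℚ.∣_∣ (solve 4 (λ p q r s → (p :- r) :+ (q :- s) := (p :+ q) :- (r :+ s)) refl p q r s))
      (ℚₚ.∣p+q∣≤∣p∣+∣q∣ (p ℚ.- r) (q ℚ.- s))

    dist-* : ∀ p q r s → dist (p ℚ.* q) (r ℚ.* s) ℚ.≤ ℚ.∣ p ∣ ℚ.* dist q s ℚ.+ ℚ.∣ s ∣ ℚ.* dist p r
    dist-* p q r s = subst₂ ℚ._≤_
      (cong ℚ.∣_∣ (solve 4 (λ p q r s → p :* (q :- s) :+ s :* (p :- r) := p :* q :- r :* s) refl p q r s))
      (cong₂ ℚ._+_ (ℚₚ.∣p*q∣≡∣p∣*∣q∣ p (q ℚ.- s)) (ℚₚ.∣p*q∣≡∣p∣*∣q∣ s (p ℚ.- r)))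
      (ℚₚ.∣p+q∣≤∣p∣+∣q∣ (p ℚ.* (q ℚ.- s)) (s ℚ.* (p ℚ.- r)))

    ∣∣-shift : ∀ p q → ℚ.∣ p ∣ ℚ.≤ dist p q ℚ.+ ℚ.∣ q ∣
    ∣∣-shift p q = subst (ℚ._≤ dist p q ℚ.+ ℚ.∣ q ∣)
      (cong ℚ.∣_∣ (solve 2 (λ p q → (p :- q) :+ q := p) refl p q))
      (ℚₚ.∣p+q∣≤∣p∣+∣q∣ (p ℚ.- q) q)

    p≤∣p∣ : ∀ p → p ℚ.≤ ℚ.∣ p ∣
    p≤∣p∣ p with ℚₚ.≤-total 0ℚ p
    ... | inj₁ 0≤p = ℚₚ.≤-reflexive (≡.sym (ℚₚ.0≤p⇒∣p∣≡p 0≤p))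
    ... | inj₂ p≤0 = ℚₚ.≤-trans p≤0 (ℚₚ.0≤∣p∣ p)

    -p≤∣p∣ : ∀ p → ℚ.- p ℚ.≤ ℚ.∣ p ∣
    -p≤∣p∣ p = subst (ℚ.- p ℚ.≤_) (ℚₚ.∣-p∣≡∣p∣ p) (p≤∣p∣ (ℚ.- p))

    0<½ : 0ℚ ℚ.< ½
    0<½ = ℚₚ.positive⁻¹ ½

    0<1 : 0ℚ ℚ.< 1ℚ
    0<1 = ℚₚ.positive⁻¹ 1ℚ

    *-pos : ∀ {p q} → 0ℚ ℚ.< p → 0ℚ ℚ.< q → 0ℚ ℚ.< p ℚ.* q
    *-pos {p} {q} 0<p 0<q =
      subst (ℚ._< p ℚ.* q) (ℚₚ.*-zeroʳ p) (ℚₚ.*-monoʳ-<-pos p {{ℚ.positive 0<p}} 0<q)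

    *-nonNeg : ∀ {p q} → 0ℚ ℚ.≤ p → 0ℚ ℚ.≤ q → 0ℚ ℚ.≤ p ℚ.* q
    *-nonNeg {p} {q} 0≤p 0≤q =
      subst (ℚ._≤ p ℚ.* q) (ℚₚ.*-zeroʳ p) (ℚₚ.*-monoˡ-≤-nonNeg p {{ℚ.nonNegative 0≤p}} 0≤q)

    *-mono-≤ : ∀ {p q r s} → 0ℚ ℚ.≤ p → 0ℚ ℚ.≤ s → p ℚ.≤ r → q ℚ.≤ s → p ℚ.* q ℚ.≤ r ℚ.* s
    *-mono-≤ {p} {q} {r} {s} 0≤p 0≤s p≤r q≤s = ℚₚ.≤-trans
      (ℚₚ.*-monoˡ-≤-nonNeg p {{ℚ.nonNegative 0≤p}} q≤s)
      (ℚₚ.*-monoʳ-≤-nonNeg s {{ℚ.nonNegative 0≤s}} p≤r)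

    half-pos : ∀ {ε} → 0ℚ ℚ.< ε → 0ℚ ℚ.< ε ℚ.* ½
    half-pos 0<ε = *-pos 0<ε 0<½

    half+half : ∀ ε → ε ℚ.* ½ ℚ.+ ε ℚ.* ½ ≡ ε
    half+half ε = ≡.trans (≡.sym (ℚₚ.*-distribˡ-+ ε ½ ½)) (ℚₚ.*-identityʳ ε)

    half<self : ∀ {ε} → 0ℚ ℚ.< ε → ε ℚ.* ½ ℚ.< ε
    half<self {ε} 0<ε = subst₂ ℚ._<_ (ℚₚ.+-identityˡ _) (half+half ε)
      (ℚₚ.+-monoˡ-< (ε ℚ.* ½) (half-pos 0<ε))

    quotient : ∀ {B ε} → 0ℚ ℚ.< B → 0ℚ ℚ.< ε → ∃[ δ ] (0ℚ ℚ.< δ × B ℚ.* δ ≡ ε)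
    quotient {B} {ε} 0<B 0<ε = B⁻¹ ℚ.* ε , *-pos 0<B⁻¹ 0<ε , eq
      where
      instance
        B⁺ : ℚ.Positive B
        B⁺ = ℚ.positive 0<B
        B≢0 : ℚ.NonZero B
        B≢0 = ℚₚ.pos⇒nonZero B
      B⁻¹ : ℚ
      B⁻¹ = ℚ.1/ B
      0<B⁻¹ : 0ℚ ℚ.< B⁻¹
      0<B⁻¹ = ℚₚ.positive⁻¹ B⁻¹ {{ℚₚ.1/pos⇒pos B}}
      eq : B ℚ.* (B⁻¹ ℚ.* ε) ≡ ε
      eq = ≡.trans (≡.sym (ℚₚ.*-assoc B B⁻¹ ε))
             (≡.trans (cong (ℚ._* ε) (ℚₚ.*-inverseʳ B)) (ℚₚ.*-identityˡ ε))

    -- If p and q are almost non-negative, then so is p * q.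
    *-almost-nonNeg : ∀ {p q B C δ} → 0ℚ ℚ.< δ → ℚ.∣ p ∣ ℚ.< B → ℚ.∣ q ∣ ℚ.< C →
      ℚ.- p ℚ.< δ → ℚ.- q ℚ.< δ → 0ℚ ℚ.≤ p ℚ.* q ℚ.+ (B ℚ.+ C) ℚ.* δ
    *-almost-nonNeg {p} {q} {B} {C} {δ} 0<δ p<B q<C -p<δ -q<δ = go (ℚₚ.≤-total 0ℚ p) (ℚₚ.≤-total 0ℚ q)
      where
      open ℚₚ.≤-Reasoning
      0≤δ : 0ℚ ℚ.≤ δ
      0≤δ = ℚₚ.<⇒≤ 0<δ
      0≤B : 0ℚ ℚ.≤ B
      0≤B = ℚₚ.≤-trans (ℚₚ.0≤∣p∣ p) (ℚₚ.<⇒≤ p<B)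
      0≤C : 0ℚ ℚ.≤ C
      0≤C = ℚₚ.≤-trans (ℚₚ.0≤∣p∣ q) (ℚₚ.<⇒≤ q<C)
      ∣∣-neg : ∀ {r} → r ℚ.≤ 0ℚ → ℚ.- r ℚ.< δ → ℚ.∣ r ∣ ℚ.≤ δ
      ∣∣-neg {r} r≤0 -r<δ = subst (ℚ._≤ δ)
        (≡.trans (≡.sym (ℚₚ.0≤p⇒∣p∣≡p (ℚₚ.neg-antimono-≤ r≤0))) (ℚₚ.∣-p∣≡∣p∣ r)) (ℚₚ.<⇒≤ -r<δ)
      finish : ∀ {S} → ℚ.∣ p ∣ ℚ.* ℚ.∣ q ∣ ℚ.≤ S → S ℚ.≤ (B ℚ.+ C) ℚ.* δ →
        0ℚ ℚ.≤ p ℚ.* q ℚ.+ (B ℚ.+ C) ℚ.* δ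
      finish {S} pq≤S S≤ = begin
        0ℚ                                   ≡⟨ ≡.sym (ℚₚ.+-inverseʳ (p ℚ.* q)) ⟩
        p ℚ.* q ℚ.- p ℚ.* q                  ≤⟨ ℚₚ.+-monoʳ-≤ (p ℚ.* q) (-p≤∣p∣ (p ℚ.* q)) ⟩
        p ℚ.* q ℚ.+ ℚ.∣ p ℚ.* q ∣            ≡⟨ cong (p ℚ.* q ℚ.+_) (ℚₚ.∣p*q∣≡∣p∣*∣q∣ p q) ⟩
        p ℚ.* q ℚ.+ ℚ.∣ p ∣ ℚ.* ℚ.∣ q ∣      ≤⟨ ℚₚ.+-monoʳ-≤ (p ℚ.* q) (ℚₚ.≤-trans pq≤S S≤) ⟩
        p ℚ.* q ℚ.+ (B ℚ.+ C) ℚ.* δ          ∎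
      go : 0ℚ ℚ.≤ p ⊎ p ℚ.≤ 0ℚ → 0ℚ ℚ.≤ q ⊎ q ℚ.≤ 0ℚ → 0ℚ ℚ.≤ p ℚ.* q ℚ.+ (B ℚ.+ C) ℚ.* δ
      go (inj₁ 0≤p) (inj₁ 0≤q) = begin
        0ℚ ℚ.+ 0ℚ                      ≤⟨ ℚₚ.+-mono-≤ (*-nonNeg 0≤p 0≤q)
                                             (*-nonNeg (ℚₚ.+-mono-≤ 0≤B 0≤C) 0≤δ) ⟩
        p ℚ.* q ℚ.+ (B ℚ.+ C) ℚ.* δ    ∎
      go (inj₂ p≤0) _ = finish (*-mono-≤ (ℚₚ.0≤∣p∣ p) 0≤C (∣∣-neg p≤0 -p<δ) (ℚₚ.<⇒≤ q<C)) (begin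
        δ ℚ.* C                        ≡⟨ solve 2 (λ δ C → δ :* C := con 0ℚ :+ C :* δ) refl δ C ⟩
        0ℚ ℚ.+ C ℚ.* δ                 ≤⟨ ℚₚ.+-monoˡ-≤ (C ℚ.* δ) (*-nonNeg 0≤B 0≤δ) ⟩
        B ℚ.* δ ℚ.+ C ℚ.* δ            ≡⟨ ≡.sym (ℚₚ.*-distribʳ-+ δ B C) ⟩
        (B ℚ.+ C) ℚ.* δ                ∎)
      go _ (inj₂ q≤0) = finish (*-mono-≤ (ℚₚ.0≤∣p∣ p) 0≤δ (ℚₚ.<⇒≤ p<B) (∣∣-neg q≤0 -q<δ)) (begin
        B ℚ.* δ                        ≡⟨ solve 2 (λ δ B → B :* δ := B :* δ :+ con 0ℚ) refl δ B ⟩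
        B ℚ.* δ ℚ.+ 0ℚ                 ≤⟨ ℚₚ.+-monoʳ-≤ (B ℚ.* δ) (*-nonNeg 0≤C 0≤δ) ⟩
        B ℚ.* δ ℚ.+ C ℚ.* δ            ≡⟨ ≡.sym (ℚₚ.*-distribʳ-+ δ B C) ⟩
        (B ℚ.+ C) ℚ.* δ                ∎)

open Estimates

------------------------------------------------------------------------
-- The real numbers: Cauchy sequences of rationals, identified (by the
-- setoid equality _≃_) when their difference tends to 0

record ℝ : Set where
  no-eta-equality
  field
    seq    : ℕ → ℚ
    cauchy : ∀ ε → 0ℚ ℚ.< ε → ∃[ N ] ∀ m n → N ℕ.≤ m → N ℕ.≤ n → ℚ.∣ seq m ℚ.- seq n ∣ ℚ.< ε

open ℝ public

Eventually : (ℕ → Set) → Set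
Eventually P = ∃[ N ] ∀ n → N ℕ.≤ n → P n

infix 4 _≃_ _≤_ _<_

record _≃_ (x y : ℝ) : Set where
  constructor mk≃
  field
    close : ∀ ε → 0ℚ ℚ.< ε → Eventually λ n → ℚ.∣ seq x n ℚ.- seq y n ∣ ℚ.< ε

record _≤_ (x y : ℝ) : Set where
  constructor mk≤
  field
    below : ∀ ε → 0ℚ ℚ.< ε → Eventually λ n → seq x n ℚ.< seq y n ℚ.+ ε

record _<_ (x y : ℝ) : Set where
  constructor mk<
  field
    gap   : ℚ
    0<gap : 0ℚ ℚ.< gap
    apart : Eventually λ n → seq x n ℚ.+ gap ℚ.< seq y n

open _≃_ public
open _≤_ public
open _<_ public

Ev-map : ∀ {P Q : ℕ → Set} → (∀ n → P n → Q n) → Eventually P → Eventually Q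
Ev-map f (N , p) = N , λ n N≤n → f n (p n N≤n)

Ev-zip : ∀ {P Q R : ℕ → Set} → (∀ n → P n → Q n → R n) →
  Eventually P → Eventually Q → Eventually R
Ev-zip f (M , p) (N , q) = M ℕ.⊔ N , λ n M⊔N≤n →
  f n (p n (ℕₚ.≤-trans (ℕₚ.m≤m⊔n M N) M⊔N≤n)) (q n (ℕₚ.≤-trans (ℕₚ.m≤n⊔m M N) M⊔N≤n))

bound : (x : ℝ) → ∃[ B ] (0ℚ ℚ.< B × Eventually λ n → ℚ.∣ seq x n ∣ ℚ.< B)
bound x with cauchy x 1ℚ 0<1
... | N , x-cauchy = 1ℚ ℚ.+ ℚ.∣ seq x N ∣
  , ℚₚ.+-mono-<-≤ 0<1 (ℚₚ.0≤∣p∣ (seq x N))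
  , N , λ n N≤n → ℚₚ.≤-<-trans (∣∣-shift (seq x n) (seq x N))
      (ℚₚ.+-monoˡ-< ℚ.∣ seq x N ∣ (x-cauchy n N N≤n ℕₚ.≤-refl))

*-step : ∀ {B C δ ε p q} r s → (B ℚ.+ C) ℚ.* δ ≡ ε → 0ℚ ℚ.< δ →
  ℚ.∣ p ∣ ℚ.< B → ℚ.∣ s ∣ ℚ.< C → dist p r ℚ.< δ → dist q s ℚ.< δ →
  dist (p ℚ.* q) (r ℚ.* s) ℚ.< ε
*-step {B} {C} {δ} {ε} {p} {q} r s eq 0<δ p<B s<C p~r q~s = begin-strict
  dist (p ℚ.* q) (r ℚ.* s)                            ≤⟨ dist-* p q r s ⟩
  ℚ.∣ p ∣ ℚ.* dist q s ℚ.+ ℚ.∣ s ∣ ℚ.* dist p r       ≤⟨ ℚₚ.+-mono-≤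
    (*-mono-≤ (ℚₚ.0≤∣p∣ p) (ℚₚ.<⇒≤ 0<δ) ℚₚ.≤-refl (ℚₚ.<⇒≤ q~s))
    (*-mono-≤ (ℚₚ.0≤∣p∣ s) (ℚₚ.<⇒≤ 0<δ) ℚₚ.≤-refl (ℚₚ.<⇒≤ p~r)) ⟩
  ℚ.∣ p ∣ ℚ.* δ ℚ.+ ℚ.∣ s ∣ ℚ.* δ                     <⟨ ℚₚ.+-mono-<
    (ℚₚ.*-monoˡ-<-pos δ {{ℚ.positive 0<δ}} p<B) (ℚₚ.*-monoˡ-<-pos δ {{ℚ.positive 0<δ}} s<C) ⟩
  B ℚ.* δ ℚ.+ C ℚ.* δ                                 ≡⟨ ≡.sym (ℚₚ.*-distribʳ-+ δ B C) ⟩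
  (B ℚ.+ C) ℚ.* δ                                     ≡⟨ eq ⟩
  ε                                                   ∎
  where open ℚₚ.≤-Reasoning

constant : ℚ → ℝ
constant q .seq    _     = q
constant q .cauchy ε 0<ε = 0 , λ _ _ _ _ → subst (ℚ._< ε) (≡.sym (dist-self q)) 0<ε

0ℝ 1ℝ : ℝ
0ℝ = constant 0ℚ
1ℝ = constant 1ℚ

infixl 6 _+_ _-_
infixl 7 _*_
infix  8 -_

_+_ : ℝ → ℝ → ℝ
(x + y) .seq    n     = seq x n ℚ.+ seq y n
(x + y) .cauchy ε 0<ε =
  let M , x-cauchy = cauchy x (ε ℚ.* ½) (half-pos 0<ε)
      N , y-cauchy = cauchy y (ε ℚ.* ½) (half-pos 0<ε)
  in M ℕ.⊔ N , λ m n ≤m ≤n → subst (dist (seq x m ℚ.+ seq y m) (seq x n ℚ.+ seq y n) ℚ.<_) (half+half ε)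
       (ℚₚ.≤-<-trans (dist-+ (seq x m) (seq y m) (seq x n) (seq y n))
         (ℚₚ.+-mono-<
           (x-cauchy m n (ℕₚ.≤-trans (ℕₚ.m≤m⊔n M N) ≤m) (ℕₚ.≤-trans (ℕₚ.m≤m⊔n M N) ≤n))
           (y-cauchy m n (ℕₚ.≤-trans (ℕₚ.m≤n⊔m M N) ≤m) (ℕₚ.≤-trans (ℕₚ.m≤n⊔m M N) ≤n))))

-_ : ℝ → ℝ
(- x) .seq    n     = ℚ.- seq x n
(- x) .cauchy ε 0<ε =
  let N , x-cauchy = cauchy x ε 0<ε
  in N , λ m n ≤m ≤n → subst (ℚ._< ε) (≡.sym (dist-neg (seq x m) (seq x n))) (x-cauchy m n ≤m ≤n)

_-_ : ℝ → ℝ → ℝ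
x - y = x + - y

_*_ : ℝ → ℝ → ℝ
(x * y) .seq    n     = seq x n ℚ.* seq y n
(x * y) .cauchy ε 0<ε =
  let B , 0<B , M₁ , x<B = bound x
      C , 0<C , M₂ , y<C = bound y
      δ , 0<δ , eq       = quotient (ℚₚ.+-mono-< 0<B 0<C) 0<ε
      N₁ , x-cauchy      = cauchy x δ 0<δ
      N₂ , y-cauchy      = cauchy y δ 0<δ
      M = M₁ ℕ.⊔ M₂
      N = N₁ ℕ.⊔ N₂
      M≤ = λ {n} (≤n : M ℕ.⊔ N ℕ.≤ n) → ℕₚ.≤-trans (ℕₚ.m≤m⊔n M N) ≤n
      N≤ = λ {n} (≤n : M ℕ.⊔ N ℕ.≤ n) → ℕₚ.≤-trans (ℕₚ.m≤n⊔m M N) ≤n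
      N₁≤ = λ {n} (≤n : M ℕ.⊔ N ℕ.≤ n) → ℕₚ.≤-trans (ℕₚ.m≤m⊔n N₁ N₂) (N≤ ≤n)
      N₂≤ = λ {n} (≤n : M ℕ.⊔ N ℕ.≤ n) → ℕₚ.≤-trans (ℕₚ.m≤n⊔m N₁ N₂) (N≤ ≤n)
  in M ℕ.⊔ N , λ m n ≤m ≤n → *-step (seq x n) (seq y n) eq 0<δ
       (x<B m (ℕₚ.≤-trans (ℕₚ.m≤m⊔n M₁ M₂) (M≤ ≤m)))
       (y<C n (ℕₚ.≤-trans (ℕₚ.m≤n⊔m M₁ M₂) (M≤ ≤n)))
       (x-cauchy m n (N₁≤ ≤m) (N₁≤ ≤n)) (y-cauchy m n (N₂≤ ≤m) (N₂≤ ≤n))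

pointwise⇒≃ : ∀ {x y} → (∀ n → seq x n ≡ seq y n) → x ≃ y
pointwise⇒≃ {x} {y} eq .close ε 0<ε = 0 , λ n _ →
  subst (ℚ._< ε) (≡.sym (≡.trans (cong (dist (seq x n)) (≡.sym (eq n))) (dist-self (seq x n)))) 0<ε

≃-refl : ∀ {x} → x ≃ x
≃-refl = pointwise⇒≃ λ _ → refl

≃-sym : ∀ {x y} → x ≃ y → y ≃ x
≃-sym {x} {y} x≃y .close ε 0<ε =
  Ev-map (λ n → subst (ℚ._< ε) (dist-sym (seq x n) (seq y n))) (close x≃y ε 0<ε)

≃-trans : ∀ {x y z} → x ≃ y → y ≃ z → x ≃ z
≃-trans {x} {y} {z} x≃y y≃z .close ε 0<ε = Ev-zip
  (λ n p q → subst (dist (seq x n) (seq z n) ℚ.<_) (half+half ε)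
    (ℚₚ.≤-<-trans (dist-triangle (seq x n) (seq y n) (seq z n)) (ℚₚ.+-mono-< p q)))
  (close x≃y _ (half-pos 0<ε)) (close y≃z _ (half-pos 0<ε))

+-cong : ∀ {x y u v} → x ≃ y → u ≃ v → x + u ≃ y + v
+-cong {x} {y} {u} {v} x≃y u≃v .close ε 0<ε = Ev-zip
  (λ n p q → subst (dist (seq (x + u) n) (seq (y + v) n) ℚ.<_) (half+half ε)
    (ℚₚ.≤-<-trans (dist-+ (seq x n) (seq u n) (seq y n) (seq v n)) (ℚₚ.+-mono-< p q)))
  (close x≃y _ (half-pos 0<ε)) (close u≃v _ (half-pos 0<ε))

neg-cong : ∀ {x y} → x ≃ y → - x ≃ - y
neg-cong {x} {y} x≃y .close ε 0<ε =
  Ev-map (λ n → subst (ℚ._< ε) (≡.sym (dist-neg (seq x n) (seq y n)))) (close x≃y ε 0<ε)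

*-cong : ∀ {x y u v} → x ≃ y → u ≃ v → x * u ≃ y * v
*-cong {x} {y} {u} {v} x≃y u≃v .close ε 0<ε =
  let B , 0<B , x<B = bound x
      C , 0<C , v<C = bound v
      δ , 0<δ , eq  = quotient (ℚₚ.+-mono-< 0<B 0<C) 0<ε
  in Ev-zip (λ n (p , q) (r , s) → *-step (seq y n) (seq v n) eq 0<δ p q r s)
       (Ev-zip (λ _ → _,_) x<B v<C) (Ev-zip (λ _ → _,_) (close x≃y δ 0<δ) (close u≃v δ 0<δ))

abstract
  ℝ-isCommutativeRing : IsCommutativeRing _≃_ _+_ _*_ -_ 0ℝ 1ℝ
  ℝ-isCommutativeRing = record
    { isRing = record
      { +-isAbelianGroup = record
        { isGroup = record
          { isMonoid = record
            { isSemigroup = record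
              { isMagma = record
                { isEquivalence = record { refl = ≃-refl ; sym = ≃-sym ; trans = ≃-trans }
                ; ∙-cong        = +-cong
                }
              ; assoc = λ x y z → pointwise⇒≃ λ n → ℚₚ.+-assoc (seq x n) (seq y n) (seq z n)
              }
            ; identity = (λ x → pointwise⇒≃ λ n → ℚₚ.+-identityˡ (seq x n))
                       , (λ x → pointwise⇒≃ λ n → ℚₚ.+-identityʳ (seq x n))
            }
          ; inverse = (λ x → pointwise⇒≃ λ n → ℚₚ.+-inverseˡ (seq x n))
                    , (λ x → pointwise⇒≃ λ n → ℚₚ.+-inverseʳ (seq x n))
          ; ⁻¹-cong = neg-cong
          }
        ; comm = λ x y → pointwise⇒≃ λ n → ℚₚ.+-comm (seq x n) (seq y n)
        }
      ; *-cong     = *-cong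
      ; *-assoc    = λ x y z → pointwise⇒≃ λ n → ℚₚ.*-assoc (seq x n) (seq y n) (seq z n)
      ; *-identity = (λ x → pointwise⇒≃ λ n → ℚₚ.*-identityˡ (seq x n))
                   , (λ x → pointwise⇒≃ λ n → ℚₚ.*-identityʳ (seq x n))
      ; distrib = (λ x y z → pointwise⇒≃ λ n → ℚₚ.*-distribˡ-+ (seq x n) (seq y n) (seq z n))
                , (λ x y z → pointwise⇒≃ λ n → ℚₚ.*-distribʳ-+ (seq x n) (seq y n) (seq z n))
      }
    ; *-comm = λ x y → pointwise⇒≃ λ n → ℚₚ.*-comm (seq x n) (seq y n)
    }

ℝ-commutativeRing : CommutativeRing _ _
ℝ-commutativeRing = record { isCommutativeRing = ℝ-isCommutativeRing }

≃⇒≤ : ∀ {x y} → x ≃ y → x ≤ y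
≃⇒≤ {x} {y} x≃y .below ε 0<ε = Ev-map step (close x≃y ε 0<ε)
  where
  open +-*-Solver
  step : ∀ n → dist (seq x n) (seq y n) ℚ.< ε → seq x n ℚ.< seq y n ℚ.+ ε
  step n p = subst (ℚ._< seq y n ℚ.+ ε)
    (solve 2 (λ x y → y :+ (x :- y) := x) refl (seq x n) (seq y n))
    (ℚₚ.+-monoʳ-< (seq y n) (ℚₚ.≤-<-trans (p≤∣p∣ _) p))

≤-refl : ∀ {x} → x ≤ x
≤-refl = ≃⇒≤ ≃-refl

≤-trans : ∀ {x y z} → x ≤ y → y ≤ z → x ≤ z
≤-trans {x} {y} {z} x≤y y≤z .below ε 0<ε =
  Ev-zip step (below x≤y _ (half-pos 0<ε)) (below y≤z _ (half-pos 0<ε))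
  where
  step : ∀ n → seq x n ℚ.< seq y n ℚ.+ ε ℚ.* ½ → seq y n ℚ.< seq z n ℚ.+ ε ℚ.* ½ →
    seq x n ℚ.< seq z n ℚ.+ ε
  step n p q = subst (seq x n ℚ.<_)
    (≡.trans (ℚₚ.+-assoc (seq z n) (ε ℚ.* ½) (ε ℚ.* ½)) (cong (seq z n ℚ.+_) (half+half ε)))
    (ℚₚ.<-trans p (ℚₚ.+-monoˡ-< (ε ℚ.* ½) q))

<⇒≤ : ∀ {x y} → x < y → x ≤ y
<⇒≤ {x} {y} (mk< δ 0<δ x+δ<y) .below ε 0<ε = Ev-map step x+δ<y
  where
  step : ∀ n → seq x n ℚ.+ δ ℚ.< seq y n → seq x n ℚ.< seq y n ℚ.+ ε
  step n p = subst (ℚ._< seq y n ℚ.+ ε) (ℚₚ.+-identityʳ (seq x n))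
    (ℚₚ.+-mono-< (ℚₚ.≤-<-trans
      (subst (ℚ._≤ seq x n ℚ.+ δ) (ℚₚ.+-identityʳ (seq x n)) (ℚₚ.+-monoʳ-≤ (seq x n) (ℚₚ.<⇒≤ 0<δ))) p) 0<ε)

+-mono-≤ : ∀ {x y u v} → x ≤ y → u ≤ v → x + u ≤ y + v
+-mono-≤ {x} {y} {u} {v} x≤y u≤v .below ε 0<ε =
  Ev-zip step (below x≤y _ (half-pos 0<ε)) (below u≤v _ (half-pos 0<ε))
  where
  open +-*-Solver
  step : ∀ n → seq x n ℚ.< seq y n ℚ.+ ε ℚ.* ½ → seq u n ℚ.< seq v n ℚ.+ ε ℚ.* ½ →
    seq (x + u) n ℚ.< seq (y + v) n ℚ.+ ε
  step n p q = subst (seq (x + u) n ℚ.<_)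
    (≡.trans (solve 3 (λ y v h → (y :+ h) :+ (v :+ h) := (y :+ v) :+ (h :+ h)) refl
                (seq y n) (seq v n) (ε ℚ.* ½))
      (cong (seq (y + v) n ℚ.+_) (half+half ε)))
    (ℚₚ.+-mono-< p q)

0≤-* : ∀ {x y} → 0ℝ ≤ x → 0ℝ ≤ y → 0ℝ ≤ x * y
0≤-* {x} {y} 0≤x 0≤y .below ε 0<ε =
  let B , 0<B , x<B = bound x
      C , 0<C , y<C = bound y
      δ , 0<δ , eq  = quotient (ℚₚ.+-mono-< 0<B 0<C) (half-pos 0<ε)
  in Ev-zip
       (λ n (p , q) (r , s) → ℚₚ.≤-<-trans
         (subst (λ h → 0ℚ ℚ.≤ seq x n ℚ.* seq y n ℚ.+ h) eq
           (*-almost-nonNeg 0<δ p q (flip-sign {seq x n} r) (flip-sign {seq y n} s)))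
         (ℚₚ.+-monoʳ-< (seq x n ℚ.* seq y n) (half<self 0<ε)))
       (Ev-zip (λ _ → _,_) x<B y<C) (Ev-zip (λ _ → _,_) (below 0≤x δ 0<δ) (below 0≤y δ 0<δ))
  where
  open +-*-Solver
  flip-sign : ∀ {p δ} → 0ℚ ℚ.< p ℚ.+ δ → ℚ.- p ℚ.< δ
  flip-sign {p} {δ} 0<p+δ = subst₂ ℚ._<_ (ℚₚ.+-identityʳ (ℚ.- p))
    (solve 2 (λ p δ → :- p :+ (p :+ δ) := δ) refl p δ) (ℚₚ.+-monoʳ-< (ℚ.- p) 0<p+δ)

------------------------------------------------------------------------
-- Coefficients of convex combinations

open CommutativeRing ℝ-commutativeRing using (+-identityˡ; +-identityʳ; *-identityʳ; -‿inverseʳ)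
open import Algebra.Properties.Semiring.Sum (CommutativeRing.semiring ℝ-commutativeRing) public
  using (sum; sum-cong-≋; ∑-comm; *-distribˡ-sum)

record Weights (n : ℕ) : Set where
  field
    weight   : Fin (suc n) → ℝ
    0≤weight : ∀ i → 0ℝ ≤ weight i
    weight≤1 : ∀ i → weight i ≤ 1ℝ
    total    : sum weight ≃ 1ℝ

open Weights public

0≤sum : ∀ {n} (x : Fin n → ℝ) → (∀ i → 0ℝ ≤ x i) → 0ℝ ≤ sum x
0≤sum {ℕ.zero} x 0≤x = ≤-refl
0≤sum {suc n}  x 0≤x =
  ≤-trans (≃⇒≤ (≃-sym (+-identityˡ 0ℝ))) (+-mono-≤ (0≤x zero) (0≤sum (x ∘ suc) (0≤x ∘ suc)))

summand≤sum : ∀ {n} (x : Fin n → ℝ) → (∀ i → 0ℝ ≤ x i) → ∀ i → x i ≤ sum x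
summand≤sum {suc n} x 0≤x zero =
  ≤-trans (≃⇒≤ (≃-sym (+-identityʳ (x zero)))) (+-mono-≤ ≤-refl (0≤sum (x ∘ suc) (0≤x ∘ suc)))
summand≤sum {suc n} x 0≤x (suc i) =
  ≤-trans (≃⇒≤ (≃-sym (+-identityˡ (x (suc i)))))
          (+-mono-≤ (0≤x zero) (summand≤sum (x ∘ suc) (0≤x ∘ suc) i))

weights : ∀ {n} (x : Fin (suc n) → ℝ) → (∀ i → 0ℝ ≤ x i) → sum x ≃ 1ℝ → Weights n
weights x 0≤x ∑x≃1 .weight     = x
weights x 0≤x ∑x≃1 .0≤weight   = 0≤x
weights x 0≤x ∑x≃1 .weight≤1 i = ≤-trans (summand≤sum x 0≤x i) (≃⇒≤ ∑x≃1)
weights x 0≤x ∑x≃1 .total      = ∑x≃1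

-- The coefficients ∑ᵢ pᵢ qᵢⱼ.
mixture : ∀ {n m} → Weights n → (Fin (suc n) → Weights m) → Weights m
mixture {n} {m} p q = weights pq 0≤pq ∑pq≃1
  where
  open import Relation.Binary.Reasoning.Setoid (CommutativeRing.setoid ℝ-commutativeRing)
  pq : Fin (suc m) → ℝ
  pq j = sum λ i → weight p i * weight (q i) j
  abstract
    0≤pq : ∀ j → 0ℝ ≤ pq j
    0≤pq j = 0≤sum (λ i → weight p i * weight (q i) j) λ i → 0≤-* (0≤weight p i) (0≤weight (q i) j)
    ∑pq≃1 : sum pq ≃ 1ℝ
    ∑pq≃1 = begin
      sum pq
        ≈⟨ ∑-comm (λ j i → weight p i * weight (q i) j) ⟩
      sum (λ i → sum λ j → weight p i * weight (q i) j)
        ≈⟨ sum-cong-≋ {x = λ i → weight p i * sum (weight (q i))} (λ i → *-distribˡ-sum (weight p i) (weight (q i))) ⟨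
      sum (λ i → weight p i * sum (weight (q i)))
        ≈⟨ sum-cong-≋ {y = λ i → weight p i * 1ℝ} (λ i → *-cong ≃-refl (total (q i))) ⟩
      sum (λ i → weight p i * 1ℝ)
        ≈⟨ sum-cong-≋ {y = weight p} (λ i → *-identityʳ (weight p i)) ⟩
      sum (weight p)
        ≈⟨ total p ⟩
      1ℝ ∎

-- The coefficients p, p̄ with p̄ = 1 - p.
binary : (p : ℝ) → 0ℝ ≤ p → p ≤ 1ℝ → Weights 1
binary p 0≤p p≤1 = weights pp̄ 0≤pp̄ ∑pp̄≃1
  where
  open +-*-Solver
  pp̄ : Fin 2 → ℝ
  pp̄ = p ∷ (1ℝ - p) ∷ []
  abstract
    0≤pp̄ : ∀ i → 0ℝ ≤ pp̄ i
    0≤pp̄ zero       = 0≤p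
    0≤pp̄ (suc zero) = ≤-trans (≃⇒≤ (≃-sym (-‿inverseʳ p))) (+-mono-≤ p≤1 ≤-refl)
    ∑pp̄≃1 : sum pp̄ ≃ 1ℝ
    ∑pp̄≃1 = pointwise⇒≃ λ n →
      solve 1 (λ p → p :+ ((con 1ℚ :- p) :+ con 0ℚ) := con 1ℚ) refl (seq p n)

------------------------------------------------------------------------
-- The category of convex algebras; sets are represented by setoids

record ConvexAlgebra c ℓ : Set (lsuc (c ⊔ ℓ)) where
  field
    setoid : Setoid c ℓ

  open Setoid setoid public

  field
    comb       : ∀ {n} → Weights n → (Fin (suc n) → Carrier) → Carrier
    comb-cong  : ∀ {n} {p q : Weights n} {x y : Fin (suc n) → Carrier} →
                 (∀ i → weight p i ≃ weight q i) → (∀ i → x i ≈ y i) → comb p x ≈ comb q y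
    projection : ∀ {n} (p : Weights n) (x : Fin (suc n) → Carrier) (j : Fin (suc n)) →
                 weight p j ≃ 1ℝ → comb p x ≈ x j
    barycenter : ∀ {n m} (p : Weights n) (q : Fin (suc n) → Weights m) (x : Fin (suc m) → Carrier) →
                 comb p (λ i → comb (q i) x) ≈ comb (mixture p q) x

infix 4 _⟶_ _≗_

record _⟶_ (𝕏 : ConvexAlgebra c ℓ) (𝕐 : ConvexAlgebra c′ ℓ′) : Set (c ⊔ ℓ ⊔ c′ ⊔ ℓ′) where
  private
    module X = ConvexAlgebra 𝕏
    module Y = ConvexAlgebra 𝕐
  field
    to        : X.Carrier → Y.Carrier
    to-cong   : ∀ {x y} → x X.≈ y → to x Y.≈ to y
    preserves : ∀ {n} (p : Weights n) (x : Fin (suc n) → X.Carrier) →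
                to (X.comb p x) Y.≈ Y.comb p (to ∘ x)

open _⟶_ public

_≗_ : {𝕏 : ConvexAlgebra c ℓ} {𝕐 : ConvexAlgebra c′ ℓ′} → 𝕏 ⟶ 𝕐 → 𝕏 ⟶ 𝕐 → Set (c ⊔ ℓ′)
_≗_ {𝕏 = 𝕏} {𝕐} f g = ∀ x → ConvexAlgebra._≈_ 𝕐 (to f x) (to g x)

idₕ : (𝕏 : ConvexAlgebra c ℓ) → 𝕏 ⟶ 𝕏
idₕ 𝕏 = record { to = λ x → x ; to-cong = λ x≈y → x≈y ; preserves = λ _ _ → ConvexAlgebra.refl 𝕏 }

infixr 9 _∘ₕ_

_∘ₕ_ : {𝕏 : ConvexAlgebra c ℓ} {𝕐 : ConvexAlgebra c′ ℓ′} {ℤ : ConvexAlgebra c″ ℓ″} →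
       𝕐 ⟶ ℤ → 𝕏 ⟶ 𝕐 → 𝕏 ⟶ ℤ
_∘ₕ_ {ℤ = ℤ} g f = record
  { to        = to g ∘ to f
  ; to-cong   = to-cong g ∘ to-cong f
  ; preserves = λ p x → ConvexAlgebra.trans ℤ (to-cong g (preserves f p x)) (preserves g p (to f ∘ x))
  }

record Endofunctor c ℓ : Set (lsuc (c ⊔ ℓ)) where
  field
    F₀             : ConvexAlgebra c ℓ → ConvexAlgebra c ℓ
    F₁             : ∀ {𝕏 𝕐} → 𝕏 ⟶ 𝕐 → F₀ 𝕏 ⟶ F₀ 𝕐
    F-resp-≗       : ∀ {𝕏 𝕐} {f g : 𝕏 ⟶ 𝕐} → f ≗ g → F₁ f ≗ F₁ g
    F-identity     : ∀ {𝕏} → F₁ (idₕ 𝕏) ≗ idₕ (F₀ 𝕏)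
    F-homomorphism : ∀ {𝕏 𝕐 ℤ} (f : 𝕏 ⟶ 𝕐) (g : 𝕐 ⟶ ℤ) → F₁ (g ∘ₕ f) ≗ F₁ g ∘ₕ F₁ f

------------------------------------------------------------------------
-- One-point extensions

-- 𝕏 is (up to the embedding ι) a subalgebra of 𝔼, and the carrier of 𝔼 is X ∪ {∗} with ∗ ∉ X.
record OnePointExtension (𝕏 : ConvexAlgebra c ℓ) (𝔼 : ConvexAlgebra c′ ℓ′) :
                         Set (c ⊔ ℓ ⊔ c′ ⊔ ℓ′) where
  private
    module X = ConvexAlgebra 𝕏
    module E = ConvexAlgebra 𝔼
  field
    ι           : 𝕏 ⟶ 𝔼
    ι-injective : ∀ {x y} → to ι x E.≈ to ι y → x X.≈ y
    ∗           : E.Carrier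
    ∗∉X         : ∀ x → ¬ to ι x E.≈ ∗
    X∪∗         : ∀ z → (∃[ x ] z E.≈ to ι x) ⊎ z E.≈ ∗

-- p x + (1 - p) ∗ = ∗ for all x ∈ X and p ∈ (0,1).
IsBlackHoleExtension : {𝕏 : ConvexAlgebra c ℓ} {𝔼 : ConvexAlgebra c′ ℓ′} → OnePointExtension 𝕏 𝔼 → Set (c ⊔ ℓ′)
IsBlackHoleExtension {𝕏 = 𝕏} {𝔼} ext =
  ∀ (x : X.Carrier) (p : ℝ) (0<p : 0ℝ < p) (p<1 : p < 1ℝ) →
  E.comb (binary p (<⇒≤ {0ℝ} {p} 0<p) (<⇒≤ {p} {1ℝ} p<1)) (to ι x ∷ ∗ ∷ []) E.≈ ∗
  where
  module X = ConvexAlgebra 𝕏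
  module E = ConvexAlgebra 𝔼
  open OnePointExtension ext

{-# OPTIONS --safe #-}

-- Everything is decided in F𝟙, 𝟙 the one-point algebra. For inhabited 𝕏 the map 𝕏 → 𝟙 has a section,
-- so F(𝕏 → 𝟙) sends ∗ to ∗. Hence if some Ff sent ∗ to a point y of 𝕐, then 𝕏 would be empty, all maps
-- 𝕏 → F𝟙 would agree, and composing f with two distinct constant maps 𝕐 → F𝟙 gives a contradiction.
--
-- If p x + p̄ ∗ were a point of 𝕏, then p tt + p̄ ∗ = tt in F𝟙. Were q tt + q̄ ∗ = ∗ for a rational
-- q ≥ p, then scaling by p / q would give p tt + p̄ ∗ = ∗; so q tt + q̄ ∗ = tt. The maps 𝟙 → ℝ carry
-- this to q r + q̄ ∗ = r for every real r. But if x and y satisfy q x + q̄ ∗ = x and q y + q̄ ∗ = y,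
-- then i x + iq y = i y + iq x for i = 1 / (1 + q), which fails for x = 1 and y = 0.

module Submission where

open import Algebra.Bundles using (CommutativeRing)
open import Defs
open import Data.Fin.Base using (Fin; zero; suc)
open import Data.Nat.Base as ℕ using (ℕ)
import Data.Nat.Properties as ℕₚ
open import Data.Product.Base using (∃-syntax; _×_; _,_; proj₁; proj₂)
open import Data.Rational.Base as ℚ using (ℚ; 0ℚ; 1ℚ)
import Data.Rational.Properties as ℚₚ
open import Data.Rational.Solver using (module +-*-Solver)
open import Data.Sum.Base using (inj₁; inj₂)
open import Data.Unit.Polymorphic.Base using (⊤; tt)
open import Data.Vec.Functional using ([]; _∷_)
open import Function.Base using (_∘_; const)
open import Level using (Level; Lift; lift; lower)
open import Relation.Binary.PropositionalEquality as ≡ using (_≡_; cong; subst; subst₂)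
open import Relation.Nullary.Negation using (¬_; contradiction)
import Relation.Binary.Reasoning.Setoid as SetoidReasoning

open OnePointExtension
open Endofunctor
open Estimates
open CommutativeRing ℝ-commutativeRing
  using (+-identityˡ; +-identityʳ; *-assoc; *-identityˡ; zeroˡ; -‿inverseʳ)
  renaming (setoid to ℝ-setoid)
open import Algebra.Properties.Semiring.Sum (CommutativeRing.semiring ℝ-commutativeRing)
  using (*-distribʳ-sum; sum-replicate-zero)

private
  variable
    c ℓ c′ ℓ′ : Level
    n : ℕ

-- Order and finite sums of real numbers.

≤-antisym : ∀ {x y} → x ≤ y → y ≤ x → x ≃ y
≤-antisym {x} {y} x≤y y≤x .close ε 0<ε = Ev-zip step (below x≤y ε 0<ε) (below y≤x ε 0<ε)
  where
  open +-*-Solver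
  minus : ∀ {a b} → a ℚ.< b ℚ.+ ε → a ℚ.- b ℚ.< ε
  minus {a} {b} a<b+ε = subst (a ℚ.- b ℚ.<_)
    (solve 2 (λ b ε → (b :+ ε) :- b := ε) ≡.refl b ε) (ℚₚ.+-monoˡ-< (ℚ.- b) a<b+ε)
  step : ∀ n → seq x n ℚ.< seq y n ℚ.+ ε → seq y n ℚ.< seq x n ℚ.+ ε →
    dist (seq x n) (seq y n) ℚ.< ε
  step n p q with ℚₚ.≤-total 0ℚ (seq x n ℚ.- seq y n)
  ... | inj₁ 0≤d = subst (ℚ._< ε) (≡.sym (ℚₚ.0≤p⇒∣p∣≡p 0≤d)) (minus p)
  ... | inj₂ d≤0 = subst (ℚ._< ε) eq (minus q)
    where
    eq : seq y n ℚ.- seq x n ≡ dist (seq x n) (seq y n)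
    eq = ≡.trans (solve 2 (λ x y → y :- x := :- (x :- y)) ≡.refl (seq x n) (seq y n))
      (≡.trans (≡.sym (ℚₚ.0≤p⇒∣p∣≡p (ℚₚ.neg-antimono-≤ d≤0)))
               (ℚₚ.∣-p∣≡∣p∣ (seq x n ℚ.- seq y n)))

constant-mono-≤ : ∀ {a b} → a ℚ.≤ b → constant a ≤ constant b
constant-mono-≤ {a} {b} a≤b .below ε 0<ε = 0 , λ _ _ →
  subst (ℚ._< b ℚ.+ ε) (ℚₚ.+-identityʳ a) (ℚₚ.+-mono-≤-< a≤b 0<ε)

<⇒constant-≄ : ∀ {a b} → a ℚ.< b → ¬ constant a ≃ constant b
<⇒constant-≄ {a} {b} a<b a≃b =
  let N , near = close a≃b (b ℚ.- a) 0<b-a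
  in ℚₚ.<-irrefl ≡.refl (ℚₚ.≤-<-trans
       (subst (b ℚ.- a ℚ.≤_) (dist-sym b a) (p≤∣p∣ (b ℚ.- a))) (near N ℕₚ.≤-refl))
  where
  0<b-a : 0ℚ ℚ.< b ℚ.- a
  0<b-a = subst (ℚ._< b ℚ.- a) (ℚₚ.+-inverseʳ a) (ℚₚ.+-monoˡ-< (ℚ.- a) a<b)

sum≤0⇒≃0 : (x : Fin n → ℝ) → (∀ i → 0ℝ ≤ x i) → sum x ≤ 0ℝ → ∀ i → x i ≃ 0ℝ
sum≤0⇒≃0 x 0≤x ∑x≤0 i = ≤-antisym (≤-trans (summand≤sum x 0≤x i) ∑x≤0) (0≤x i)

+-cancelˡ-≤ : ∀ x {y z} → x + y ≤ x + z → y ≤ z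
+-cancelˡ-≤ x {y} {z} le =
  ≤-trans (≃⇒≤ (cancel y)) (≤-trans (+-mono-≤ (≤-refl { - x}) le) (≃⇒≤ (≃-sym (cancel z))))
  where
  open +-*-Solver
  cancel : ∀ w → w ≃ - x + (x + w)
  cancel w = pointwise⇒≃ λ k →
    solve 2 (λ x w → w := :- x :+ (x :+ w)) ≡.refl (seq x k) (seq w k)

-- All weights other than `w j` vanish, since they are non-negative and leave no room in the sum.
-- The hypothesis is a bound rather than `w j ≃ 1ℝ` with total 1 because the bound passes to the
-- tail of `w` in the induction. This yields Projection for the reals.
concentrated-sum : (w x : Fin n → ℝ) → (∀ i → 0ℝ ≤ w i) → ∀ j → sum w ≤ w j →
  sum (λ i → w i * x i) ≃ w j * x j
concentrated-sum {ℕ.suc n} w x 0≤w zero ∑w≤ = ≃-trans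
  (+-cong ≃-refl (≃-trans
    (sum-cong-≋ {y = const 0ℝ} λ i → ≃-trans (*-cong (rest≃0 i) ≃-refl) (zeroˡ (x (suc i))))
    (sum-replicate-zero n)))
  (+-identityʳ _)
  where
  rest≃0 : ∀ i → w (suc i) ≃ 0ℝ
  rest≃0 = sum≤0⇒≃0 (w ∘ suc) (0≤w ∘ suc)
    (+-cancelˡ-≤ (w zero) (≤-trans ∑w≤ (≃⇒≤ (≃-sym (+-identityʳ (w zero))))))
concentrated-sum w x 0≤w (suc j) ∑w≤ = ≃-trans
  (+-cong (≃-trans (*-cong w₀≃0 ≃-refl) (zeroˡ (x zero)))
          (concentrated-sum (w ∘ suc) (x ∘ suc) (0≤w ∘ suc) j ∑rest≤))
  (+-identityˡ _)
  where
  rest : ℝ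
  rest = sum (w ∘ suc)
  ∑rest≤ : rest ≤ w (suc j)
  ∑rest≤ = ≤-trans (≃⇒≤ (≃-sym (+-identityˡ rest))) (≤-trans (+-mono-≤ (0≤w zero) ≤-refl) ∑w≤)
  -- `w zero + rest` is at most `w (suc j)`, itself a summand of `rest`; cancelling `rest` leaves
  -- `w zero ≤ 0ℝ`.
  w₀≃0 : w zero ≃ 0ℝ
  w₀≃0 = ≤-antisym
    (+-cancelˡ-≤ rest (≤-trans (≃⇒≤ (pointwise⇒≃ λ k → ℚₚ.+-comm (seq rest k) (seq (w zero) k)))
      (≤-trans ∑w≤ (≤-trans (summand≤sum (w ∘ suc) (0≤w ∘ suc) j)
        (≃⇒≤ (≃-sym (+-identityʳ rest)))))))
    (0≤w zero)

-- The test algebras: the reals and a single point.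

-- Carrier and equality are lifted to arbitrary levels so that a functor on algebras of levels `c`
-- and `ℓ` can be applied.
ℝ-algebra : ∀ c ℓ → ConvexAlgebra c ℓ
ℝ-algebra c ℓ = record
  { setoid = record
    { Carrier       = Lift c ℝ
    ; _≈_           = λ x y → Lift ℓ (lower x ≃ lower y)
    ; isEquivalence = record
      { refl  = lift ≃-refl
      ; sym   = λ x≈y → lift (≃-sym (lower x≈y))
      ; trans = λ x≈y y≈z → lift (≃-trans (lower x≈y) (lower y≈z))
      }
    }
  ; comb       = λ p x → lift (sum λ i → weight p i * lower (x i))
  ; comb-cong  = λ p≃q x≈y → lift (sum-cong-≋ λ i → *-cong (p≃q i) (lower (x≈y i)))
  ; projection = λ p x j pⱼ≃1 → lift (≃-trans
      (concentrated-sum (weight p) (lower ∘ x) (0≤weight p) j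
        (≃⇒≤ (≃-trans (total p) (≃-sym pⱼ≃1))))
      (≃-trans (*-cong pⱼ≃1 ≃-refl) (*-identityˡ (lower (x j)))))
  ; barycenter = λ p q x → lift (bary p q (lower ∘ x))
  }
  where
  open SetoidReasoning ℝ-setoid
  bary : ∀ {n m} (p : Weights n) (q : Fin (ℕ.suc n) → Weights m) (x : Fin (ℕ.suc m) → ℝ) →
    sum (λ i → weight p i * sum λ j → weight (q i) j * x j) ≃
    sum (λ j → weight (mixture p q) j * x j)
  bary p q x = begin
    sum (λ i → weight p i * sum λ j → weight (q i) j * x j)
      ≈⟨ sum-cong-≋ (λ i → *-distribˡ-sum (weight p i) λ j → weight (q i) j * x j) ⟩
    sum (λ i → sum λ j → weight p i * (weight (q i) j * x j))
      ≈⟨ sum-cong-≋ (λ i → sum-cong-≋ λ j → ≃-sym (*-assoc (weight p i) (weight (q i) j) (x j))) ⟩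
    sum (λ i → sum λ j → weight p i * weight (q i) j * x j)
      ≈⟨ ∑-comm (λ i j → weight p i * weight (q i) j * x j) ⟩
    sum (λ j → sum λ i → weight p i * weight (q i) j * x j)
      ≈⟨ sum-cong-≋ (λ j → ≃-sym (*-distribʳ-sum (x j) λ i → weight p i * weight (q i) j)) ⟩
    sum (λ j → weight (mixture p q) j * x j) ∎

unit-algebra : ∀ c ℓ → ConvexAlgebra c ℓ
unit-algebra c ℓ = record
  { setoid     = record
    { Carrier       = ⊤
    ; _≈_           = λ _ _ → ⊤
    ; isEquivalence = record { refl = tt ; sym = λ _ → tt ; trans = λ _ _ → tt }
    }
  ; comb       = λ _ _ → tt
  ; comb-cong  = λ _ _ → tt
  ; projection = λ _ _ _ _ → tt
  ; barycenter = λ _ _ _ → tt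
  }

-- Point masses and calculation in a convex algebra.

kronecker : Fin n → Fin n → ℝ
kronecker zero    zero    = 1ℝ
kronecker zero    (suc j) = 0ℝ
kronecker (suc i) zero    = 0ℝ
kronecker (suc i) (suc j) = kronecker i j

0≤kronecker : (i j : Fin n) → 0ℝ ≤ kronecker i j
0≤kronecker zero    zero    = constant-mono-≤ (ℚₚ.<⇒≤ 0<1)
0≤kronecker zero    (suc j) = ≤-refl
0≤kronecker (suc i) zero    = ≤-refl
0≤kronecker (suc i) (suc j) = 0≤kronecker i j

kronecker-diagonal : (i : Fin n) → kronecker i i ≃ 1ℝ
kronecker-diagonal zero    = ≃-refl
kronecker-diagonal (suc i) = kronecker-diagonal i

sum-kronecker : (i : Fin n) → sum (kronecker i) ≃ 1ℝ
sum-kronecker {ℕ.suc n} zero = ≃-trans (+-cong ≃-refl (sum-replicate-zero n)) (+-identityʳ 1ℝ)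
sum-kronecker (suc i)        = ≃-trans (+-identityˡ _) (sum-kronecker i)

dirac : Fin (ℕ.suc n) → Weights n
dirac i = weights (kronecker i) (0≤kronecker i) (sum-kronecker i)

weight-complement : (p : Weights 1) → weight p (suc zero) ≃ 1ℝ - weight p zero
weight-complement p = ≃-trans
  (pointwise⇒≃ λ k → solve 2 (λ a b → b := (a :+ (b :+ con 0ℚ)) :- a) ≡.refl
    (seq (weight p zero) k) (seq (weight p (suc zero)) k))
  (+-cong (total p) ≃-refl)
  where open +-*-Solver

module _ (𝔸 : ConvexAlgebra c ℓ) where
  open ConvexAlgebra 𝔸

  -- Each entry `y` is rewritten as a one-term combination. Barycenter then merges everything into a
  -- one-term combination, whose only weight is the total 1, and Projection applies.
  comb-idem : (p : Weights n) (y : Carrier) → comb p (const y) ≈ y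
  comb-idem p y = begin
    comb p (const y)
      ≈⟨ comb-cong {p = p} {p} (λ _ → ≃-refl) (λ _ → sym (projection one (const y) zero ≃-refl)) ⟩
    comb p (λ _ → comb one (const y))
      ≈⟨ barycenter p (const one) (const y) ⟩
    comb (mixture p (const one)) (const y)
      ≈⟨ projection _ (const y) zero (≃-trans (≃-sym (+-identityʳ _)) (total (mixture p (const one)))) ⟩
    y ∎
    where
    open SetoidReasoning setoid
    one : Weights 0
    one = dirac zero

  comb-dirac : (x : Fin (ℕ.suc n) → Carrier) (i : Fin (ℕ.suc n)) → x i ≈ comb (dirac i) x
  comb-dirac x i = sym (projection (dirac i) x i (kronecker-diagonal i))

  -- Barycenter requires all inner combinations to range over one common family; entries that are
  -- bare points enter through `comb-dirac`.
  comb₂-mixture : (p : Weights 1) {u v : Weights n} (x : Fin (ℕ.suc n) → Carrier) {y z : Carrier} →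
    y ≈ comb u x → z ≈ comb v x → comb p (y ∷ z ∷ []) ≈ comb (mixture p (u ∷ v ∷ [])) x
  comb₂-mixture p {u} {v} x y≈ux z≈vx = trans
    (comb-cong {p = p} {p} (λ _ → ≃-refl) (λ { zero → y≈ux ; (suc zero) → z≈vx }))
    (barycenter p (u ∷ v ∷ []) x)

  -- For p = tq one has px + p̄y = t(qx + q̄y) + t̄y = ty + t̄y = y.
  comb-shrink : (p q t : Weights 1) → weight p zero ≃ weight t zero * weight q zero → ∀ {x y} →
    comb q (x ∷ y ∷ []) ≈ y → comb p (x ∷ y ∷ []) ≈ y
  comb-shrink p q t p₀≃t₀q₀ {x} {y} qxy≈y = begin
    comb p xy
      ≈⟨ comb-cong {p = p} {mixture t (q ∷ 𝕪 ∷ [])}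
           (λ { zero → eq₀ ; (suc zero) → eq₁ }) (λ _ → refl) ⟩
    comb (mixture t (q ∷ 𝕪 ∷ [])) xy
      ≈⟨ comb₂-mixture t {q} {𝕪} xy (sym qxy≈y) (comb-dirac xy (suc zero)) ⟨
    comb t (y ∷ y ∷ [])
      ≈⟨ comb-cong {p = t} {t} (λ _ → ≃-refl) (λ { zero → refl ; (suc zero) → refl }) ⟩
    comb t (const y)
      ≈⟨ comb-idem t y ⟩
    y ∎
    where
    open SetoidReasoning setoid
    open +-*-Solver
    xy : Fin 2 → Carrier
    xy = x ∷ y ∷ []
    𝕪 : Weights 1
    𝕪 = dirac (suc zero)
    p₀ q₀ t₀ : ℝ
    p₀ = weight p zero
    q₀ = weight q zero
    t₀ = weight t zero
    eq₀ : p₀ ≃ t₀ * q₀ + (weight t (suc zero) * 0ℝ + 0ℝ)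
    eq₀ = ≃-trans p₀≃t₀q₀ (pointwise⇒≃ λ k → solve 3
      (λ t₀ t₁ q₀ → t₀ :* q₀ := t₀ :* q₀ :+ (t₁ :* con 0ℚ :+ con 0ℚ))
      ≡.refl (seq t₀ k) (seq (weight t (suc zero)) k) (seq q₀ k))
    eq₁ : weight p (suc zero) ≃ t₀ * weight q (suc zero) + (weight t (suc zero) * 1ℝ + 0ℝ)
    eq₁ = ≃-trans (weight-complement p) (≃-trans (+-cong ≃-refl (neg-cong p₀≃t₀q₀)) (≃-trans
      (pointwise⇒≃ λ k → solve 2
        (λ t q → con 1ℚ :- t :* q := t :* (con 1ℚ :- q) :+ ((con 1ℚ :- t) :* con 1ℚ :+ con 0ℚ))
        ≡.refl (seq t₀ k) (seq q₀ k))
      (+-cong (*-cong ≃-refl (≃-sym (weight-complement q)))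
              (+-cong (*-cong (≃-sym (weight-complement t)) ≃-refl) ≃-refl))))

  -- Writing i, iq for the coefficients of p, both sides equal the combination of x, y, e with
  -- coefficients iq, iq², 1 - q: on the left replace x by qx + q̄e and y by qy + q̄e, on the right
  -- replace y by q²y + (1 - q²)e.
  comb-swap : (p q : Weights 1) → weight p (suc zero) ≃ weight p zero * weight q zero → ∀ {x y e} →
    comb q (x ∷ e ∷ []) ≈ x → comb q (y ∷ e ∷ []) ≈ y → comb p (x ∷ y ∷ []) ≈ comb p (y ∷ x ∷ [])
  comb-swap p q p₁≃p₀q₀ {x} {y} {e} qxe≈x qye≈y = begin
    comb p (x ∷ y ∷ [])
      ≈⟨ comb₂-mixture p {x₁} {y₁} xye x≈₁ y≈₁ ⟩
    comb (mixture p (x₁ ∷ y₁ ∷ [])) xye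
      ≈⟨ comb-cong {p = mixture p (x₁ ∷ y₁ ∷ [])} {mixture p (y₂ ∷ x₀ ∷ [])} coefficients (λ _ → refl) ⟩
    comb (mixture p (y₂ ∷ x₀ ∷ [])) xye
      ≈⟨ comb₂-mixture p {y₂} {x₀} xye y≈₂ (comb-dirac xye zero) ⟨
    comb p (y ∷ x ∷ []) ∎
    where
    open SetoidReasoning setoid
    open +-*-Solver
    xye : Fin 3 → Carrier
    xye = x ∷ y ∷ e ∷ []
    x₀ y₀ e₀ x₁ y₁ y₂ : Weights 2
    x₀ = dirac zero
    y₀ = dirac (suc zero)
    e₀ = dirac (suc (suc zero))
    x₁ = mixture q (x₀ ∷ e₀ ∷ [])
    y₁ = mixture q (y₀ ∷ e₀ ∷ [])
    y₂ = mixture q (y₁ ∷ e₀ ∷ [])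
    x≈₁ : x ≈ comb x₁ xye
    x≈₁ = trans (sym qxe≈x) (comb₂-mixture q {x₀} {e₀} xye
      (comb-dirac xye zero) (comb-dirac xye (suc (suc zero))))
    y≈₁ : y ≈ comb y₁ xye
    y≈₁ = trans (sym qye≈y) (comb₂-mixture q {y₀} {e₀} xye
      (comb-dirac xye (suc zero)) (comb-dirac xye (suc (suc zero))))
    y≈₂ : y ≈ comb y₂ xye
    y≈₂ = trans (sym qye≈y) (comb₂-mixture q {y₁} {e₀} xye y≈₁ (comb-dirac xye (suc (suc zero))))
    i q₀ q₁ : ℝ
    i  = weight p zero
    q₀ = weight q zero
    q₁ = weight q (suc zero)
    expand : ∀ a b → i * a + (weight p (suc zero) * b + 0ℝ) ≃ i * a + (i * q₀ * b + 0ℝ)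
    expand a b = +-cong ≃-refl (+-cong (*-cong p₁≃p₀q₀ ≃-refl) ≃-refl)
    mix : ∀ {n} → Polynomial n → Polynomial n → Polynomial n → Polynomial n → Polynomial n
    mix r s a b = r :* a :+ (s :* b :+ con 0ℚ)
    0# 1# : ∀ {n} → Polynomial n
    0# = con 0ℚ
    1# = con 1ℚ
    combine : ∀ j →
      (∀ k → seq (i * weight x₁ j + (i * q₀ * weight y₁ j + 0ℝ)) k ≡
             seq (i * weight y₂ j + (i * q₀ * weight x₀ j + 0ℝ)) k) →
      weight (mixture p (x₁ ∷ y₁ ∷ [])) j ≃ weight (mixture p (y₂ ∷ x₀ ∷ [])) j
    combine j eq = ≃-trans (expand (weight x₁ j) (weight y₁ j))
      (≃-trans (pointwise⇒≃ eq) (≃-sym (expand (weight y₂ j) (weight x₀ j))))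
    coefficients : ∀ j → weight (mixture p (x₁ ∷ y₁ ∷ [])) j ≃ weight (mixture p (y₂ ∷ x₀ ∷ [])) j
    coefficients zero = combine zero λ k → solve 3
      (λ i q r → mix i (i :* q) (mix q r 1# 0#) (mix q r 0# 0#) :=
                 mix i (i :* q) (mix q r (mix q r 0# 0#) 0#) 1#)
      ≡.refl (seq i k) (seq q₀ k) (seq q₁ k)
    coefficients (suc zero) = combine (suc zero) λ k → solve 3
      (λ i q r → mix i (i :* q) (mix q r 0# 0#) (mix q r 1# 0#) :=
                 mix i (i :* q) (mix q r (mix q r 1# 0#) 0#) 0#)
      ≡.refl (seq i k) (seq q₀ k) (seq q₁ k)
    coefficients (suc (suc zero)) = combine (suc (suc zero)) λ k → solve 3
      (λ i q r → mix i (i :* q) (mix q r 0# 1#) (mix q r 0# 1#) :=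
                 mix i (i :* q) (mix q r (mix q r 0# 1#) 1#) 0#)
      ≡.refl (seq i k) (seq q₀ k) (seq q₁ k)

-- Constant maps, and the obstruction found in extensions of the reals.

const-hom : (𝕏 : ConvexAlgebra c ℓ) (𝕐 : ConvexAlgebra c′ ℓ′) → ConvexAlgebra.Carrier 𝕐 → 𝕏 ⟶ 𝕐
const-hom 𝕏 𝕐 y = record
  { to        = const y
  ; to-cong   = λ _ → ConvexAlgebra.refl 𝕐
  ; preserves = λ p _ → ConvexAlgebra.sym 𝕐 (comb-idem 𝕐 p y)
  }

-- Composing `to f` with a two-entry vector gives the vector of images only pointwise, so
-- `comb-cong` has to bridge the two.
preserves₂ : {𝕏 : ConvexAlgebra c ℓ} {𝕐 : ConvexAlgebra c′ ℓ′} →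
  let module X = ConvexAlgebra 𝕏 ; module Y = ConvexAlgebra 𝕐 in
  (f : 𝕏 ⟶ 𝕐) (p : Weights 1) → ∀ {a b a′ b′} → to f a Y.≈ a′ → to f b Y.≈ b′ →
  to f (X.comb p (a ∷ b ∷ [])) Y.≈ Y.comb p (a′ ∷ b′ ∷ [])
preserves₂ {𝕐 = 𝕐} f p {a} {b} fa≈a′ fb≈b′ = trans (preserves f p (a ∷ b ∷ []))
  (comb-cong {p = p} {p} (λ _ → ≃-refl) λ { zero → fa≈a′ ; (suc zero) → fb≈b′ })
  where open ConvexAlgebra 𝕐

-- `comb-swap` at the images of 1 and 0, pulled back along the injective `ι`, gives i = iq, against
-- q < 1 and i > 0. The weight is rational so that i can be computed by division in ℚ.
no-imitating-point : (𝔼 : ConvexAlgebra c′ ℓ′) → let module E = ConvexAlgebra 𝔼 in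
  (ι : ℝ-algebra c ℓ ⟶ 𝔼) →
  (∀ {x y} → to ι x E.≈ to ι y → ConvexAlgebra._≈_ (ℝ-algebra c ℓ) x y) →
  ∀ e (𝕢 : Weights 1) {q} → weight 𝕢 zero ≃ constant q → 0ℚ ℚ.< q → q ℚ.< 1ℚ →
  ¬ (∀ x → E.comb 𝕢 (to ι x ∷ e ∷ []) E.≈ to ι x)
no-imitating-point {c = c} {ℓ = ℓ} 𝔼 ι ι-injective e 𝕢 {q} 𝕢₀≃q 0<q q<1 imitates =
  <⇒constant-≄ iq<i (≃-trans (≃-sym i₁≃iq) (≃-trans (≃-sym second) (≃-trans (≃-sym swapped) first)))
  where
  open ConvexAlgebra 𝔼
  open ConvexAlgebra (ℝ-algebra c ℓ) using () renaming (comb to combℝ)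
  open +-*-Solver
  -- i = 1 / (1 + q) makes the complementary weight 1 - i equal to iq, the ratio that `comb-swap`
  -- asks for.
  inverse : ∃[ i ] (0ℚ ℚ.< i × (1ℚ ℚ.+ q) ℚ.* i ≡ 1ℚ)
  inverse = quotient (ℚₚ.+-mono-< 0<1 0<q) 0<1
  i : ℚ
  i = proj₁ inverse
  0<i : 0ℚ ℚ.< i
  0<i = proj₁ (proj₂ inverse)
  i+iq≡1 : i ℚ.+ i ℚ.* q ≡ 1ℚ
  i+iq≡1 = ≡.trans (solve 2 (λ i q → i :+ i :* q := (con 1ℚ :+ q) :* i) ≡.refl i q)
    (proj₂ (proj₂ inverse))
  iq<i : i ℚ.* q ℚ.< i
  iq<i = subst (i ℚ.* q ℚ.<_) (ℚₚ.*-identityʳ i) (ℚₚ.*-monoʳ-<-pos i {{ℚ.positive 0<i}} q<1)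
  i≤1 : i ℚ.≤ 1ℚ
  i≤1 = subst₂ ℚ._≤_ (ℚₚ.+-identityʳ i) i+iq≡1 (ℚₚ.+-monoʳ-≤ i (ℚₚ.<⇒≤ (*-pos 0<i 0<q)))
  𝕚 : Weights 1
  𝕚 = binary (constant i) (constant-mono-≤ (ℚₚ.<⇒≤ 0<i)) (constant-mono-≤ i≤1)
  i₁≃iq : 1ℝ - constant i ≃ constant (i ℚ.* q)
  i₁≃iq = pointwise⇒≃ λ _ → ≡.trans (cong (ℚ._- i) (≡.sym i+iq≡1))
    (solve 2 (λ i q → (i :+ i :* q) :- i := i :* q) ≡.refl i q)
  i₁≃i*𝕢₀ : 1ℝ - constant i ≃ constant i * weight 𝕢 zero
  i₁≃i*𝕢₀ = ≃-trans i₁≃iq (≃-trans (pointwise⇒≃ λ _ → ≡.refl) (*-cong (≃-refl {constant i}) (≃-sym 𝕢₀≃q)))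
  x y : Lift c ℝ
  x = lift 1ℝ
  y = lift 0ℝ
  first : lower (combℝ 𝕚 (x ∷ y ∷ [])) ≃ constant i
  first = pointwise⇒≃ λ _ → solve 1
    (λ i → i :* con 1ℚ :+ ((con 1ℚ :- i) :* con 0ℚ :+ con 0ℚ) := i) ≡.refl i
  second : lower (combℝ 𝕚 (y ∷ x ∷ [])) ≃ 1ℝ - constant i
  second = pointwise⇒≃ λ _ → solve 1
    (λ i → i :* con 0ℚ :+ ((con 1ℚ :- i) :* con 1ℚ :+ con 0ℚ) := con 1ℚ :- i) ≡.refl i
  swapped : lower (combℝ 𝕚 (x ∷ y ∷ [])) ≃ lower (combℝ 𝕚 (y ∷ x ∷ []))
  swapped = lower (ι-injective {combℝ 𝕚 (x ∷ y ∷ [])} {combℝ 𝕚 (y ∷ x ∷ [])} (trans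
    (preserves₂ ι 𝕚 refl refl)
    (trans (comb-swap 𝔼 𝕚 𝕢 i₁≃i*𝕢₀ (imitates x) (imitates y))
           (sym (preserves₂ ι 𝕚 refl refl)))))

-- Comparing a real weight with a rational one.

rational-between : ∀ {p} → 0ℝ < p → p < 1ℝ →
  ∃[ q ] (0ℚ ℚ.< q × q ℚ.< 1ℚ × p ≤ constant q)
rational-between {p} (mk< γ 0<γ (M , γ<p)) (mk< δ 0<δ (N , p+δ<1)) =
  -- `δ` is the rational gap that comes with `p < 1ℝ`. Positivity of 1 - δ is read off at the index
  -- `M ℕ.⊔ N`, where both gap estimates hold.
  1ℚ ℚ.- δ , 0<1-δ , 1-δ<1 , p≤1-δ
  where
  open +-*-Solver
  shift : ∀ {a} → a ℚ.+ δ ℚ.< 1ℚ → a ℚ.< 1ℚ ℚ.- δ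
  shift {a} a+δ<1 = subst (ℚ._< 1ℚ ℚ.- δ)
    (solve 2 (λ a δ → (a :+ δ) :- δ := a) ≡.refl a δ) (ℚₚ.+-monoˡ-< (ℚ.- δ) a+δ<1)
  0<1-δ : 0ℚ ℚ.< 1ℚ ℚ.- δ
  0<1-δ = ℚₚ.<-trans (ℚₚ.<-trans (subst (0ℚ ℚ.<_) (≡.sym (ℚₚ.+-identityˡ γ)) 0<γ)
      (γ<p (M ℕ.⊔ N) (ℕₚ.m≤m⊔n M N)))
    (shift {seq p (M ℕ.⊔ N)} (p+δ<1 (M ℕ.⊔ N) (ℕₚ.m≤n⊔m M N)))
  1-δ<1 : 1ℚ ℚ.- δ ℚ.< 1ℚ
  1-δ<1 = ℚₚ.+-monoʳ-< 1ℚ (ℚₚ.neg-antimono-< 0<δ)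
  p≤1-δ : p ≤ constant (1ℚ ℚ.- δ)
  p≤1-δ .below ε 0<ε = N , λ n N≤n → subst (ℚ._< (1ℚ ℚ.- δ) ℚ.+ ε) (ℚₚ.+-identityʳ (seq p n))
    (ℚₚ.+-mono-< (shift {seq p n} (p+δ<1 n N≤n)) 0<ε)

ratio : ∀ {p q} → 0ℝ ≤ p → p ≤ constant q → 0ℚ ℚ.< q →
  ∃[ t ] (0ℝ ≤ t × t ≤ 1ℝ × p ≃ t * constant q)
ratio {p} {q} 0≤p p≤q 0<q = t , 0≤-* 0≤p 0≤q⁻¹ , t≤1 , p≃tq
  where
  inverse : ∃[ r ] (0ℚ ℚ.< r × q ℚ.* r ≡ 1ℚ)
  inverse = quotient 0<q 0<1
  q⁻¹ : ℚ
  q⁻¹ = proj₁ inverse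
  qq⁻¹≡1 : q ℚ.* q⁻¹ ≡ 1ℚ
  qq⁻¹≡1 = proj₂ (proj₂ inverse)
  0≤q⁻¹ : 0ℝ ≤ constant q⁻¹
  0≤q⁻¹ = constant-mono-≤ (ℚₚ.<⇒≤ (proj₁ (proj₂ inverse)))
  t : ℝ
  t = p * constant q⁻¹
  open +-*-Solver
  0≤q-p : 0ℝ ≤ constant q - p
  0≤q-p = ≤-trans (≃⇒≤ (≃-sym (-‿inverseʳ p))) (+-mono-≤ p≤q ≤-refl)
  -- Adding the non-negative real (q - p) / q to t = p / q gives 1.
  t≤1 : t ≤ 1ℝ
  t≤1 = ≤-trans (≃⇒≤ (≃-sym (+-identityʳ t)))
    (≤-trans (+-mono-≤ ≤-refl (0≤-* 0≤q-p 0≤q⁻¹)) (≃⇒≤ (pointwise⇒≃ λ k →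
      ≡.trans (solve 3 (λ p q r → p :* r :+ (q :- p) :* r := q :* r) ≡.refl (seq p k) q q⁻¹) qq⁻¹≡1)))
  p≃tq : p ≃ t * constant q
  p≃tq = pointwise⇒≃ λ k → ≡.sym (≡.trans
    (solve 3 (λ p q r → p :* r :* q := p :* (q :* r)) ≡.refl (seq p k) q q⁻¹)
    (≡.trans (cong (seq p k ℚ.*_) qq⁻¹≡1) (ℚₚ.*-identityʳ (seq p k))))

-- The action of the functor on the added points, and absorption.

module _ (F : Endofunctor c ℓ) (ext : ∀ 𝕏 → OnePointExtension 𝕏 (F₀ F 𝕏))
         (natural : ∀ {𝕏 𝕐 : ConvexAlgebra c ℓ} (f : 𝕏 ⟶ 𝕐) → F₁ F f ∘ₕ ι (ext 𝕏) ≗ ι (ext 𝕐) ∘ₕ f)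
         where

  private
    𝟙 : ConvexAlgebra c ℓ
    𝟙 = unit-algebra c ℓ

    module F𝟙 = ConvexAlgebra (F₀ F 𝟙)

    to𝟙 : (𝕏 : ConvexAlgebra c ℓ) → 𝕏 ⟶ 𝟙
    to𝟙 𝕏 = const-hom 𝕏 𝟙 tt

    point : (𝕏 : ConvexAlgebra c ℓ) → ConvexAlgebra.Carrier 𝕏 → 𝟙 ⟶ 𝕏
    point = const-hom 𝟙

  -- `point 𝕏 x` is a section of `to𝟙 𝕏`, and functors preserve sections.
  F-to𝟙-point : ∀ 𝕏 x z → to (F₁ F (to𝟙 𝕏)) (to (F₁ F (point 𝕏 x)) z) F𝟙.≈ z
  F-to𝟙-point 𝕏 x z = begin
    to (F₁ F (to𝟙 𝕏)) (to (F₁ F (point 𝕏 x)) z)  ≈⟨ F-homomorphism F (point 𝕏 x) (to𝟙 𝕏) z ⟨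
    to (F₁ F (to𝟙 𝕏 ∘ₕ point 𝕏 x)) z             ≈⟨ F-resp-≗ F {f = to𝟙 𝕏 ∘ₕ point 𝕏 x} {idₕ 𝟙} (λ _ → tt) z ⟩
    to (F₁ F (idₕ 𝟙)) z                        ≈⟨ F-identity F z ⟩
    z                                          ∎
    where open SetoidReasoning F𝟙.setoid

  -- Were the image a point of 𝕏, the retraction `F₁ F (to𝟙 𝕏)` would send it to the point of 𝟙 by
  -- naturality, yet it must return `∗ (ext 𝟙)`.
  F-point-∗ : ∀ 𝕏 x → ConvexAlgebra._≈_ (F₀ F 𝕏) (to (F₁ F (point 𝕏 x)) (∗ (ext 𝟙))) (∗ (ext 𝕏))
  F-point-∗ 𝕏 x with X∪∗ (ext 𝕏) (to (F₁ F (point 𝕏 x)) (∗ (ext 𝟙)))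
  ... | inj₂ ≈∗ = ≈∗
  ... | inj₁ (x′ , ≈ιx′) = contradiction (begin
    to (ι (ext 𝟙)) tt                                  ≈⟨ natural (to𝟙 𝕏) x′ ⟨
    to (F₁ F (to𝟙 𝕏)) (to (ι (ext 𝕏)) x′)                ≈⟨ to-cong (F₁ F (to𝟙 𝕏)) ≈ιx′ ⟨
    to (F₁ F (to𝟙 𝕏)) (to (F₁ F (point 𝕏 x)) (∗ (ext 𝟙))) ≈⟨ F-to𝟙-point 𝕏 x (∗ (ext 𝟙)) ⟩
    ∗ (ext 𝟙)                                          ∎) (∗∉X (ext 𝟙) tt)
    where open SetoidReasoning F𝟙.setoid

  F-to𝟙-∗ : ∀ 𝕏 → ConvexAlgebra.Carrier 𝕏 → to (F₁ F (to𝟙 𝕏)) (∗ (ext 𝕏)) F𝟙.≈ ∗ (ext 𝟙)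
  F-to𝟙-∗ 𝕏 x = F𝟙.trans (F𝟙.sym (to-cong (F₁ F (to𝟙 𝕏)) (F-point-∗ 𝕏 x))) (F-to𝟙-point 𝕏 x (∗ (ext 𝟙)))

  F-∗ : ∀ {𝕏 𝕐} (f : 𝕏 ⟶ 𝕐) → ConvexAlgebra._≈_ (F₀ F 𝕐) (to (F₁ F f) (∗ (ext 𝕏))) (∗ (ext 𝕐))
  F-∗ {𝕏} {𝕐} f with X∪∗ (ext 𝕐) (to (F₁ F f) (∗ (ext 𝕏)))
  ... | inj₂ ≈∗ = ≈∗
  ... | inj₁ (y , ≈ιy) = contradiction
    (ι-injective (ext (F₀ F 𝟙)) (FF𝟙.trans (FF𝟙.sym (value (to (ι (ext 𝟙)) tt)))
      (FF𝟙.trans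
        (F-resp-≗ F {f = k (to (ι (ext 𝟙)) tt)} {k (∗ (ext 𝟙))} (λ x → contradiction x X-empty) (∗ (ext 𝕏)))
        (value (∗ (ext 𝟙))))))
    (∗∉X (ext 𝟙) tt)
    where
    module FF𝟙 = ConvexAlgebra (F₀ F (F₀ F 𝟙))
    -- `to𝟙 𝕏` factors through `f`, so `∗ (ext 𝕏)` lands on the point of 𝟙; by `F-to𝟙-∗`, an element
    -- of 𝕏 would make it land on `∗ (ext 𝟙)`.
    X-empty : ¬ ConvexAlgebra.Carrier 𝕏
    X-empty x = ∗∉X (ext 𝟙) tt (begin
      to (ι (ext 𝟙)) tt                           ≈⟨ natural (to𝟙 𝕐) y ⟨
      to (F₁ F (to𝟙 𝕐)) (to (ι (ext 𝕐)) y)          ≈⟨ to-cong (F₁ F (to𝟙 𝕐)) ≈ιy ⟨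
      to (F₁ F (to𝟙 𝕐)) (to (F₁ F f) (∗ (ext 𝕏)))   ≈⟨ F-homomorphism F f (to𝟙 𝕐) (∗ (ext 𝕏)) ⟨
      to (F₁ F (to𝟙 𝕐 ∘ₕ f)) (∗ (ext 𝕏))            ≈⟨ F-resp-≗ F {f = to𝟙 𝕐 ∘ₕ f} {to𝟙 𝕏} (λ _ → tt) (∗ (ext 𝕏)) ⟩
      to (F₁ F (to𝟙 𝕏)) (∗ (ext 𝕏))                 ≈⟨ F-to𝟙-∗ 𝕏 x ⟩
      ∗ (ext 𝟙)                                   ∎)
      where open SetoidReasoning F𝟙.setoid
    -- The target F𝟙 is chosen because it has two distinct elements. All `k z` agree on the empty 𝕏,
    -- whereas `value` shows that `F₁ F (k z)` remembers `z` at `∗ (ext 𝕏)`.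
    k : F𝟙.Carrier → 𝕏 ⟶ F₀ F 𝟙
    k z = const-hom 𝕐 (F₀ F 𝟙) z ∘ₕ f
    value : ∀ z → to (F₁ F (k z)) (∗ (ext 𝕏)) FF𝟙.≈ to (ι (ext (F₀ F 𝟙))) z
    value z = begin
      to (F₁ F (k z)) (∗ (ext 𝕏))                        ≈⟨ F-homomorphism F f (const-hom 𝕐 (F₀ F 𝟙) z) (∗ (ext 𝕏)) ⟩
      to (F₁ F (const-hom 𝕐 (F₀ F 𝟙) z)) (to (F₁ F f) (∗ (ext 𝕏)))
                                                         ≈⟨ to-cong (F₁ F (const-hom 𝕐 (F₀ F 𝟙) z)) ≈ιy ⟩
      to (F₁ F (const-hom 𝕐 (F₀ F 𝟙) z)) (to (ι (ext 𝕐)) y)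
                                                         ≈⟨ natural (const-hom 𝕐 (F₀ F 𝟙) z) y ⟩
      to (ι (ext (F₀ F 𝟙))) z                            ∎
      where open SetoidReasoning FF𝟙.setoid

  -- `F₁ F (point 𝕏 x)` carries the equation over: it sends the point of 𝟙 to `x` and, by
  -- `F-point-∗`, the added point to the added point.
  F-preserves-imitation : (p : Weights 1) →
    F𝟙.comb p (to (ι (ext 𝟙)) tt ∷ ∗ (ext 𝟙) ∷ []) F𝟙.≈ to (ι (ext 𝟙)) tt →
    ∀ 𝕏 x → let module FX = ConvexAlgebra (F₀ F 𝕏) in
    FX.comb p (to (ι (ext 𝕏)) x ∷ ∗ (ext 𝕏) ∷ []) FX.≈ to (ι (ext 𝕏)) x
  F-preserves-imitation p p-imitates 𝕏 x = begin
    FX.comb p (to (ι (ext 𝕏)) x ∷ ∗ (ext 𝕏) ∷ [])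
      ≈⟨ preserves₂ (F₁ F (point 𝕏 x)) p (natural (point 𝕏 x) tt) (F-point-∗ 𝕏 x) ⟨
    to (F₁ F (point 𝕏 x)) (F𝟙.comb p (to (ι (ext 𝟙)) tt ∷ ∗ (ext 𝟙) ∷ []))
      ≈⟨ to-cong (F₁ F (point 𝕏 x)) p-imitates ⟩
    to (F₁ F (point 𝕏 x)) (to (ι (ext 𝟙)) tt)
      ≈⟨ natural (point 𝕏 x) tt ⟩
    to (ι (ext 𝕏)) x ∎
    where
    module FX = ConvexAlgebra (F₀ F 𝕏)
    open SetoidReasoning FX.setoid

  rational-∗-absorbing : (p : Weights 1) → ∀ {q} → weight p zero ≃ constant q → 0ℚ ℚ.< q → q ℚ.< 1ℚ →
    F𝟙.comb p (to (ι (ext 𝟙)) tt ∷ ∗ (ext 𝟙) ∷ []) F𝟙.≈ ∗ (ext 𝟙)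
  rational-∗-absorbing p p₀≃q 0<q q<1 with X∪∗ (ext 𝟙) (F𝟙.comb p (to (ι (ext 𝟙)) tt ∷ ∗ (ext 𝟙) ∷ []))
  ... | inj₂ ≈∗ = ≈∗
  ... | inj₁ (_ , ≈tt) = contradiction (F-preserves-imitation p ≈tt (ℝ-algebra c ℓ))
    (no-imitating-point (F₀ F (ℝ-algebra c ℓ)) (ι (ext (ℝ-algebra c ℓ))) (ι-injective (ext (ℝ-algebra c ℓ)))
      (∗ (ext (ℝ-algebra c ℓ))) p p₀≃q 0<q q<1)

  -- A rational q with p ≤ q < 1 is already settled, and `comb-shrink` descends from q to p = tq.
  𝟙-∗-absorbing : (p : Weights 1) → 0ℝ < weight p zero → weight p zero < 1ℝ →
    F𝟙.comb p (to (ι (ext 𝟙)) tt ∷ ∗ (ext 𝟙) ∷ []) F𝟙.≈ ∗ (ext 𝟙)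
  𝟙-∗-absorbing p 0<p p<1 = from-above (rational-between 0<p p<1)
    where
    from-above : ∃[ q ] (0ℚ ℚ.< q × q ℚ.< 1ℚ × weight p zero ≤ constant q) →
      F𝟙.comb p (to (ι (ext 𝟙)) tt ∷ ∗ (ext 𝟙) ∷ []) F𝟙.≈ ∗ (ext 𝟙)
    from-above (q , 0<q , q<1 , p≤q) = shrink (ratio (0≤weight p zero) p≤q 0<q)
      (binary (constant q) (constant-mono-≤ (ℚₚ.<⇒≤ 0<q)) (constant-mono-≤ (ℚₚ.<⇒≤ q<1))) ≃-refl
      where
      shrink : ∃[ t ] (0ℝ ≤ t × t ≤ 1ℝ × weight p zero ≃ t * constant q) →
        (𝕢 : Weights 1) → weight 𝕢 zero ≃ constant q →
        F𝟙.comb p (to (ι (ext 𝟙)) tt ∷ ∗ (ext 𝟙) ∷ []) F𝟙.≈ ∗ (ext 𝟙)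
      shrink (t , 0≤t , t≤1 , p≃tq) 𝕢 𝕢₀≃q = comb-shrink (F₀ F 𝟙) p 𝕢 (binary t 0≤t t≤1)
        (≃-trans p≃tq (*-cong ≃-refl (≃-sym 𝕢₀≃q))) (rational-∗-absorbing 𝕢 𝕢₀≃q 0<q q<1)

  -- `F₁ F (to𝟙 𝕏)` maps the combination to the corresponding one in F𝟙, which is `∗ (ext 𝟙)`; a
  -- value in 𝕏 would be mapped to the point of 𝟙 instead.
  ∗-absorbing : ∀ 𝕏 x (p : Weights 1) → 0ℝ < weight p zero → weight p zero < 1ℝ →
    let module FX = ConvexAlgebra (F₀ F 𝕏) in
    FX.comb p (to (ι (ext 𝕏)) x ∷ ∗ (ext 𝕏) ∷ []) FX.≈ ∗ (ext 𝕏)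
  ∗-absorbing 𝕏 x p 0<p p<1
    with X∪∗ (ext 𝕏) (ConvexAlgebra.comb (F₀ F 𝕏) p (to (ι (ext 𝕏)) x ∷ ∗ (ext 𝕏) ∷ []))
  ... | inj₂ ≈∗ = ≈∗
  ... | inj₁ (x′ , ≈ιx′) = contradiction (begin
    to (ι (ext 𝟙)) tt
      ≈⟨ natural (to𝟙 𝕏) x′ ⟨
    to (F₁ F (to𝟙 𝕏)) (to (ι (ext 𝕏)) x′)
      ≈⟨ to-cong (F₁ F (to𝟙 𝕏)) ≈ιx′ ⟨
    to (F₁ F (to𝟙 𝕏)) (ConvexAlgebra.comb (F₀ F 𝕏) p (to (ι (ext 𝕏)) x ∷ ∗ (ext 𝕏) ∷ []))
      ≈⟨ preserves₂ (F₁ F (to𝟙 𝕏)) p (natural (to𝟙 𝕏) x) (F-to𝟙-∗ 𝕏 x) ⟩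
    F𝟙.comb p (to (ι (ext 𝟙)) tt ∷ ∗ (ext 𝟙) ∷ [])
      ≈⟨ 𝟙-∗-absorbing p 0<p p<1 ⟩
    ∗ (ext 𝟙) ∎) (∗∉X (ext 𝟙) tt)
    where open SetoidReasoning F𝟙.setoid

  F-isBlackHoleExtension : ∀ 𝕏 → IsBlackHoleExtension (ext 𝕏)
  F-isBlackHoleExtension 𝕏 x p 0<p p<1 =
    ∗-absorbing 𝕏 x (binary p (<⇒≤ {0ℝ} {p} 0<p) (<⇒≤ {p} {1ℝ} p<1)) 0<p p<1

theorem5p3 : ∀ {c ℓ : Level} (F : Endofunctor c ℓ) (ext : ∀ 𝕏 → OnePointExtension 𝕏 (F₀ F 𝕏)) →
    (∀ {𝕏 𝕐 : ConvexAlgebra c ℓ} (f : 𝕏 ⟶ 𝕐) → F₁ F f ∘ₕ ι (ext 𝕏) ≗ ι (ext 𝕐) ∘ₕ f) →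
    (∀ (𝕏 : ConvexAlgebra c ℓ) → IsBlackHoleExtension (ext 𝕏)) ×
    (∀ {𝕏 𝕐 : ConvexAlgebra c ℓ} (f : 𝕏 ⟶ 𝕐) →
    (F₁ F f ∘ₕ ι (ext 𝕏) ≗ ι (ext 𝕐) ∘ₕ f) ×
    ConvexAlgebra._≈_ (F₀ F 𝕐) (to (F₁ F f) (∗ (ext 𝕏))) (∗ (ext 𝕐)))
theorem5p3 F ext natural =
  F-isBlackHoleExtension F ext natural , λ f → natural f , F-∗ F ext natural f
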